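{- Let $K_1,K_2$ be nonempty finite simplicial complexes (each having at least one vertex) on disjoint vertex sets, let $i\ge 0$, and let $K=K_1*K_2$ be their join. If $\dim K_1+\dim K_2\ge i+1$, then $B_i(K)$ is unbalanced.
   Context: The join $K_1*K_2$ is the complex on $V(K_1)\cup V(K_2)$ whose faces are $F_1\cup F_2$ with $F_1\in K_1$, $F_2\in K_2$. The dimension of a complex is the maximum of $|F|-1$ over its faces. $S_j(K)$ is the set of faces of cardinality $j+1$. For an oriented complex $K$ (orientation: ordering of each face up to even permutations), $B_i(K)$ is the signed bipartite graph on $S_i(K)\cup S_{i+1}(K)$ with edges $\{G,\bar G\}$ for $G\subset\bar G$, signed by the boundary incidence sign $\mathrm{sgn}([G],\partial[\bar G])\in\{\pm1\}$ ($(-1)^j$ if $G$ is $\bar G$ minus its $j$-th vertex with agreeing orientation, negated otherwise). A signed graph is balanced if every cycle has positive sign product; this property of $B_i(K)$ is independent of the orientation. -}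

module Defs where

open import Data.Empty using (⊥)
open import Data.Fin.Base using (Fin)
import Data.Fin.Properties as Fin
open import Data.Fin.Subset
  using (Subset; inside; outside; _∈_; _⊆_; _⊂_; _∪_; _∩_; ∣_∣; ⁅_⁆)
  renaming (⊥ to ∅)
open import Data.Fin.Subset.Properties
  using (_∈?_; anySubset?; ∪-identityˡ; p∩q⊆p; p∩q⊆q; ∩-distribˡ-∪; ⊆-antisym; x∈p∩q⁺)
open import Data.Integer.Base as ℤ using (ℤ; +_)
import Data.Integer.Properties as ℤ
open import Data.List.Base as List
  using (List; []; _∷_; _++_; length; filter; takeWhile)
import Data.List.Extrema
import Data.List.Membership.Propositional as List
open import Data.List.Relation.Unary.Unique.Propositional using (Unique)
open import Data.Nat.Base as ℕ using (ℕ; zero; suc; _+_; _≤_; parity)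
import Data.Nat.Properties as ℕ
open import Data.Parity.Base using (toSign)
open import Data.Product.Base using (∃; ∃₂; _×_; _,_; proj₁)
open import Data.Refinement using (Refinement; Refinement-syntax; value; refine; _,_)
open import Data.Sign.Base using (Sign; _*_) renaming (+ to ⊕)
open import Data.Sum.Base using (_⊎_; inj₁; inj₂)
import Data.Vec.Base as Vec
import Data.Vec.Properties as Vec
import Data.Bool.Properties as Bool
open import Function.Bundles using (_⇔_)
open import Level using (0ℓ)
open import Relation.Binary.Construct.Closure.ReflexiveTransitive using (Star; ε; _◅_)
open import Relation.Binary.Core using (Rel)
open import Relation.Binary.Definitions using (Symmetric)
open import Relation.Binary.PropositionalEquality using (_≡_; refl; sym; trans)
open import Relation.Nullary using (¬_; ¬?)
open import Relation.Nullary.Decidable using (_×-dec_)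
open import Relation.Unary using (Pred; Decidable)

private
  variable
    n : ℕ

-- Fin n is only an ambient set: the vertices of K are the v with
-- ⁅ v ⁆ ∈ K, so two complexes over the same n can have disjoint
-- vertex sets.
record SimplicialComplex (n : ℕ) : Set₁ where
  field
    Face   : Pred (Subset n) 0ℓ
    Face?  : Decidable Face
    ∅-face : Face ∅
    closed : ∀ {F G} → G ⊆ F → Face F → Face G

open SimplicialComplex

Vertex : SimplicialComplex n → Pred (Fin n) 0ℓ
Vertex K v = Face K ⁅ v ⁆

HasVertex : SimplicialComplex n → Set
HasVertex K = ∃ (Vertex K)

DisjointVertices : SimplicialComplex n → SimplicialComplex n → Set
DisjointVertices K L = ∀ v → ¬ (Vertex K v × Vertex L v)

infixl 7 _∗_

_∗_ : SimplicialComplex n → SimplicialComplex n → SimplicialComplex n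
K ∗ L = record
  { Face   = λ F → ∃₂ λ F₁ F₂ → Face K F₁ × Face L F₂ × F ≡ F₁ ∪ F₂
  ; Face?  = λ F → anySubset? λ F₁ → anySubset? λ F₂ →
               Face? K F₁ ×-dec Face? L F₂ ×-dec Vec.≡-dec Bool._≟_ F (F₁ ∪ F₂)
  ; ∅-face = ∅ , ∅ , ∅-face K , ∅-face L , sym (∪-identityˡ ∅)
  ; closed = λ { {G = G} G⊆F (F₁ , F₂ , k , l , refl) →
      G ∩ F₁ , G ∩ F₂ , closed K (p∩q⊆q G F₁) k , closed L (p∩q⊆q G F₂) l ,
      trans (⊆-antisym (λ x∈G → x∈p∩q⁺ (x∈G , G⊆F x∈G)) (p∩q⊆p G (F₁ ∪ F₂)))
            (∩-distribˡ-∪ G F₁ F₂) }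
  }

subsets : ∀ n → List (Subset n)
subsets zero    = Vec.[] ∷ []
subsets (suc n) =
  List.map (outside Vec.∷_) (subsets n) ++ List.map (inside Vec.∷_) (subsets n)

-- The starting value -1 of the maximum is |∅| - 1, and ∅ is a face.
dim : SimplicialComplex n → ℤ
dim {n} K = max ℤ.-1ℤ
  (List.map (λ F → + ∣ F ∣ ℤ.- ℤ.1ℤ) (filter (Face? K) (subsets n)))
  where open Data.List.Extrema ℤ.≤-totalOrder using (max)

S : ℕ → SimplicialComplex n → Set
S {n} j K = [ F ∈ Subset n ∣ (Face K F × ∣ F ∣ ≡ suc j) ]

record Ordering (F : Subset n) : Set where
  field
    list     : List (Fin n)
    unique   : Unique list
    complete : ∀ {v} → v List.∈ list ⇔ v ∈ F

-- Each class of orderings modulo even permutations is given by a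
-- representative; the signs below depend only on the class.
Orientation : SimplicialComplex n → Set
Orientation {n} K = (F : [ F ∈ Subset n ∣ Face K F ]) → Ordering (value F)

position : List (Fin n) → Fin n → ℕ
position vs v = length (takeWhile (λ w → ¬? (w Fin.≟ v)) vs)

inversions : List ℕ → ℕ
inversions []       = 0
inversions (x ∷ xs) = length (filter (ℕ._<? x) xs) + inversions xs

-- The sign of the permutation between two orderings of the same set:
-- `List.map (position ws) vs` is its one-line notation.
permutationSign : List (Fin n) → List (Fin n) → Sign
permutationSign vs ws = toSign (parity (inversions (List.map (position ws) vs)))

-- sgn([G], ∂[H]) for G = H minus one vertex.  If os lists H, the deleted
-- vertex is the j-th one (counting from 0) with j the number of entries
-- before the first one outside G, and filtering leaves the ordering of
-- G induced by os.
sgn : {G H : Subset n} → Ordering G → Ordering H → Sign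
sgn {G = G} oG oH =
  toSign (parity j) * permutationSign (filter (_∈? G) os) (Ordering.list oG)
  where
  os = Ordering.list oH
  j  = length (takeWhile (_∈? G) os)

record SignedGraph : Set₁ where
  field
    V        : Set
    _~_      : Rel V 0ℓ
    ~-sym    : Symmetric _~_
    ~-irrefl : ∀ {u} → ¬ (u ~ u)
    -- Irrelevance of the edge proof makes the graph simple: one sign
    -- for each adjacent pair.
    sign     : ∀ u v → .(u ~ v) → Sign
    sign-sym : ∀ u v .(e : u ~ v) .(e′ : v ~ u) → sign u v e ≡ sign v u e′

module _ (Γ : SignedGraph) where
  open SignedGraph Γ

  Walk : V → V → Set
  Walk = Star _~_

  -- All vertices of the walk except the last one.
  sources : ∀ {u v} → Walk u v → List V
  sources ε                 = []
  sources (_◅_ {i = u} _ w) = u ∷ sources w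

  walkSign : ∀ {u v} → Walk u v → Sign
  walkSign ε                         = ⊕
  walkSign (_◅_ {i = u} {j = v} e w) = sign u v e * walkSign w

  record Cycle : Set where
    field
      {base}   : V
      walk     : Walk base base
      distinct : Unique (sources walk)
      long     : 3 ≤ length (sources walk)

  Balanced : Set
  Balanced = (c : Cycle) → walkSign (Cycle.walk c) ≡ ⊕

  Unbalanced : Set
  Unbalanced = ¬ Balanced

B : ℕ → (K : SimplicialComplex n) → Orientation K → SignedGraph
B i K o = record
  { V        = S i K ⊎ S (suc i) K
  ; _~_      = Adj
  ; ~-sym    = λ {u} {v} → Adj-sym u v
  ; ~-irrefl = λ {u} → Adj-irrefl u
  ; sign     = σ
  ; sign-sym = σ-sym
  }
  where
  Adj : Rel (S i K ⊎ S (suc i) K) 0ℓ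
  Adj (inj₁ G) (inj₂ H) = value G ⊂ value H
  Adj (inj₂ H) (inj₁ G) = value G ⊂ value H
  Adj (inj₁ _) (inj₁ _) = ⊥
  Adj (inj₂ _) (inj₂ _) = ⊥

  Adj-sym : ∀ u v → Adj u v → Adj v u
  Adj-sym (inj₁ _) (inj₂ _) e = e
  Adj-sym (inj₂ _) (inj₁ _) e = e

  Adj-irrefl : ∀ u → ¬ Adj u u
  Adj-irrefl (inj₁ _) ()
  Adj-irrefl (inj₂ _) ()

  ordering : ∀ {j} (F : S j K) → Ordering (value F)
  ordering F = o (refine proj₁ F)

  σ : ∀ u v → .(Adj u v) → Sign
  σ (inj₁ G) (inj₂ H) _ = sgn (ordering G) (ordering H)
  σ (inj₂ H) (inj₁ G) _ = sgn (ordering G) (ordering H)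

  σ-sym : ∀ u v .(e : Adj u v) .(e′ : Adj v u) → σ u v e ≡ σ v u e′
  σ-sym (inj₁ _) (inj₂ _) _ _ = refl
  σ-sym (inj₂ _) (inj₁ _) _ _ = refl

{-# OPTIONS --safe #-}

-- The join has a face with at least i + 3 vertices a, b, c, t with |t| = i.
-- The faces x ∷ t and x ∷ y ∷ t for x, y among a, b, c form a hexagon in B_i,
-- and it is negative: writing inv F for the inversion parity of the chosen
-- ordering of F relative to the order of Fin n, the sign of G in the boundary
-- of H = G ∪ {y} is (-1)^(inv G + inv H + #{v ∈ G ∣ v < y}).  In the product
-- over the hexagon everything cancels except one -1 for each pair {x , y},
-- because exactly one of x < y and y < x holds.

module Submission where

open import Defs
open import Data.Nat.Base using (ℕ; suc)
open import Data.Integer.Base using (+_; _≥_; _+_)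
open import Data.Bool.Base using (if_then_else_; true; false)
open import Data.Fin.Base as Fin using (Fin; toℕ)
import Data.Fin.Properties as Fin
open import Data.Fin.Subset
  using (Subset; inside; outside; _∈_; _∉_; _⊂_; _∪_; ∣_∣; ⁅_⁆)
  renaming (⊥ to ∅)
open import Data.Fin.Subset.Properties
  using (_∈?_; ∉⊥; ∣⊥∣≡0; x∈⁅x⁆; x∈⁅y⁆⇒x≡y; x∈p∪q⁺; x∈p∪q⁻)
import Data.Integer.Base as ℤ
import Data.Integer.Properties as ℤ
import Data.Integer.Tactic.RingSolver as ℤSolver
open import Data.List.Base as List
  using (List; []; _∷_; _++_; length; filter; takeWhile)
import Data.List.Extrema
import Data.List.Membership.Propositional as List
open import Data.List.Membership.Propositional.Properties
  using (∈-∃++; ∈-++⁺ˡ; ∈-++⁺ʳ; ∈-++⁻; ∈-filter⁻; ∈-map⁺; ∈-map⁻)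
open import Data.List.Membership.Propositional.Properties.WithK using (unique∧set⇒bag)
open import Data.List.Properties
  using (map-∘; length-map; length-++; filter-++; filter-all; filter-reject; filter-none;
         length-take; take++drop≡id)
open import Data.List.Relation.Binary.BagAndSetEquality using (∼bag⇒↭)
open import Data.List.Relation.Binary.Permutation.Propositional
  using (_↭_; refl; prep; swap; ↭-sym)
open import Data.List.Relation.Binary.Permutation.Propositional.Properties
  using (∈-resp-↭; ↭-length; shift; drop-mid)
open import Data.List.Relation.Unary.All as All using (All; []; _∷_)
open import Data.List.Relation.Unary.AllPairs using ([]; _∷_)
open import Data.List.Relation.Unary.Any using (here; there)
open import Data.List.Relation.Unary.Unique.Propositional using (Unique)
import Data.List.Relation.Unary.Unique.Propositional.Properties as Unique
open import Data.Maybe.Base using (just; nothing)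
open import Data.Nat.Base as ℕ using (zero; parity; s≤s; z≤n)
import Data.Nat.Properties as ℕ
open import Data.Parity.Base as ℙ using (Parity; 0ℙ; 1ℙ; toSign)
import Data.Parity.Properties as ℙ
open import Algebra.Properties.CommutativeSemigroup ℙ.+-commutativeSemigroup
  using (interchange; x∙yz≈y∙xz)
open import Data.Product.Base using (∃; _×_; _,_; proj₁; proj₂)
open import Data.Refinement using (value; refine; _,_)
open import Data.Irrelevant using ([_])
open import Data.Sign.Base as Sign using (Sign)
import Data.Sign.Properties as Sign
open import Data.Sum.Base as Sum using (_⊎_; inj₁; inj₂)
import Data.Vec.Base as Vec
open import Level using (0ℓ)
open import Function.Base using (_∘_; id; case_of_)
open import Function.Bundles using (_⇔_; mk⇔; Equivalence)
open import Relation.Binary.Construct.Closure.ReflexiveTransitive using (ε; _◅_)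
open import Relation.Binary.Definitions using (DecidableEquality)
open import Relation.Binary.PropositionalEquality
  using (_≡_; _≢_; refl; sym; trans; cong; cong₂; subst; module ≡-Reasoning)
open import Relation.Nullary using (¬_; yes; no; contradiction)
open import Relation.Unary using (Pred; Decidable)
open import Tactic.RingSolver using (solve-∀)
open import Tactic.RingSolver.Core.AlmostCommutativeRing
  using (AlmostCommutativeRing; fromCommutativeRing)

open SimplicialComplex
open ≡-Reasoning

private
  variable
    A : Set
    n : ℕ

-- Sums modulo 2 over lists and over pairs of list entries.

parityRing : AlmostCommutativeRing _ _
parityRing = fromCommutativeRing ℙ.+-*-commutativeRing
  -- This zero test lets the solver drop a term such as `p + p`, whose coefficient evaluates to
  -- `0ℙ`.
  λ { 0ℙ → just refl ; 1ℙ → nothing }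

-- `<ᵇ` is the Boolean to which the test `_<?_` in `inversions` reduces, so one case split settles
-- the filter and this indicator together.
lt : ℕ → ℕ → Parity
lt m n = if m ℕ.<ᵇ n then 1ℙ else 0ℙ

lt-flip : ∀ {m n} → m ≢ n → lt m n ≡ lt n m ℙ.⁻¹
lt-flip {zero}  {zero}  m≢n = contradiction refl m≢n
lt-flip {zero}  {suc n} m≢n = refl
lt-flip {suc m} {zero}  m≢n = refl
lt-flip {suc m} {suc n} m≢n = lt-flip (m≢n ∘ cong suc)

sum : (A → Parity) → List A → Parity
sum f []       = 0ℙ
sum f (x ∷ xs) = f x ℙ.+ sum f xs

pairSum : (A → A → Parity) → List A → Parity
pairSum r []       = 0ℙ
pairSum r (x ∷ xs) = sum (r x) xs ℙ.+ pairSum r xs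

sum-+ : ∀ (f g : A → Parity) xs → sum (λ x → f x ℙ.+ g x) xs ≡ sum f xs ℙ.+ sum g xs
sum-+ f g []       = refl
sum-+ f g (x ∷ xs) = trans (cong (f x ℙ.+ g x ℙ.+_) (sum-+ f g xs))
  (interchange (f x) (g x) (sum f xs) (sum g xs))

pairSum-+ : ∀ (r s : A → A → Parity) xs →
  pairSum (λ x y → r x y ℙ.+ s x y) xs ≡ pairSum r xs ℙ.+ pairSum s xs
pairSum-+ r s []       = refl
pairSum-+ r s (x ∷ xs) = trans (cong₂ ℙ._+_ (sum-+ (r x) (s x) xs) (pairSum-+ r s xs))
  (interchange (sum (r x) xs) (sum (s x) xs) (pairSum r xs) (pairSum s xs))

sum-↭ : ∀ (f : A → Parity) {xs ys} → xs ↭ ys → sum f xs ≡ sum f ys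
sum-↭ f refl        = refl
sum-↭ f (prep x p)  = cong (f x ℙ.+_) (sum-↭ f p)
sum-↭ f (swap x y p) = trans (cong (λ z → f x ℙ.+ (f y ℙ.+ z)) (sum-↭ f p))
  (x∙yz≈y∙xz (f x) (f y) _)
sum-↭ f (_↭_.trans p q) = trans (sum-↭ f p) (sum-↭ f q)

-- Swapping neighbours reverses a single pair and only regroups the other terms. Symmetry is asked
-- only for entries of the list, since it will come from functions that are injective only there.
pairSum-↭ : ∀ (r : A → A → Parity) {xs ys} →
  (∀ {x y} → x List.∈ xs → y List.∈ xs → r x y ≡ r y x) →
  xs ↭ ys → pairSum r xs ≡ pairSum r ys
pairSum-↭ r r-sym refl       = refl
pairSum-↭ r r-sym (prep x p) = cong₂ ℙ._+_ (sum-↭ (r x) p)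
  (pairSum-↭ r (λ u v → r-sym (there u) (there v)) p)
pairSum-↭ r {_ ∷ _ ∷ xs} {_ ∷ _ ∷ ys} r-sym (swap x y p) = begin
  (r x y ℙ.+ sum (r x) xs) ℙ.+ (sum (r y) xs ℙ.+ pairSum r xs)
    ≡⟨ interchange (r x y) (sum (r x) xs) (sum (r y) xs) (pairSum r xs) ⟩
  (r x y ℙ.+ sum (r y) xs) ℙ.+ (sum (r x) xs ℙ.+ pairSum r xs)
    ≡⟨ cong₂ ℙ._+_
         (cong₂ ℙ._+_ (r-sym (here refl) (there (here refl))) (sum-↭ (r y) p))
         (cong₂ ℙ._+_ (sum-↭ (r x) p)
           (pairSum-↭ r (λ u v → r-sym (there (there u)) (there (there v))) p)) ⟩
  (r y x ℙ.+ sum (r y) ys) ℙ.+ (sum (r x) ys ℙ.+ pairSum r ys) ∎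
pairSum-↭ r r-sym (_↭_.trans p q) = trans (pairSum-↭ r r-sym p)
  (pairSum-↭ r (λ u v → r-sym (∈-resp-↭ (↭-sym p) u) (∈-resp-↭ (↭-sym p) v)) q)

unique∧set⇒↭ : ∀ {xs ys : List A} → Unique xs → Unique ys →
  (∀ {x} → x List.∈ xs ⇔ x List.∈ ys) → xs ↭ ys
unique∧set⇒↭ xs! ys! eq = ∼bag⇒↭ (unique∧set⇒bag xs! ys! eq)

-- Inversion parity

inv : (A → ℕ) → List A → Parity
inv f = pairSum (λ x y → lt (f y) (f x))

parity-suc : ∀ n → parity (suc n) ≡ parity n ℙ.⁻¹
parity-suc = ℙ.+-homo-+ 1

parity-inversions : ∀ (f : A → ℕ) xs → parity (inversions (List.map f xs)) ≡ inv f xs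
parity-inversions f []       = refl
parity-inversions f (x ∷ xs) = trans
  (ℙ.+-homo-+ (length (filter (ℕ._<? f x) (List.map f xs))) _)
  (cong₂ ℙ._+_ (count xs) (parity-inversions f xs))
  where
  count : ∀ ys → parity (length (filter (ℕ._<? f x) (List.map f ys)))
               ≡ sum (λ y → lt (f y) (f x)) ys
  count []       = refl
  count (y ∷ ys) with f y ℕ.<ᵇ f x
  ... | true  = trans (parity-suc (length (filter (ℕ._<? f x) (List.map f ys))))
                      (cong ℙ._⁻¹ (count ys))
  ... | false = count ys

-- r x y = lt (f y) (f x) + lt (g y) (g x) is symmetric in x and y, so its sum
-- over the pairs of a list does not depend on the order of the list.
inv-+-↭ : ∀ (f g : A → ℕ) {xs ys} →
  (∀ {x y} → x List.∈ xs → y List.∈ xs → f x ≡ f y → x ≡ y) →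
  (∀ {x y} → x List.∈ xs → y List.∈ xs → g x ≡ g y → x ≡ y) →
  DecidableEquality A →
  xs ↭ ys → inv f xs ℙ.+ inv g xs ≡ inv f ys ℙ.+ inv g ys
inv-+-↭ {A = A} f g {xs} {ys} f-inj g-inj _≟_ p = begin
  inv f xs ℙ.+ inv g xs   ≡⟨ pairSum-+ _ _ xs ⟨
  pairSum r xs            ≡⟨ pairSum-↭ r r-sym p ⟩
  pairSum r ys            ≡⟨ pairSum-+ _ _ ys ⟩
  inv f ys ℙ.+ inv g ys   ∎
  where
  r : A → A → Parity
  r x y = lt (f y) (f x) ℙ.+ lt (g y) (g x)

  ⁻¹-+-⁻¹ : ∀ a b → a ℙ.⁻¹ ℙ.+ b ℙ.⁻¹ ≡ a ℙ.+ b
  ⁻¹-+-⁻¹ 0ℙ b = ℙ.⁻¹-involutive b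
  ⁻¹-+-⁻¹ 1ℙ b = refl

  r-sym : ∀ {x y} → x List.∈ xs → y List.∈ xs → r x y ≡ r y x
  r-sym {x} {y} x∈ y∈ with x ≟ y
  ... | yes refl = refl
  ... | no x≢y   = trans
    (cong₂ ℙ._+_ (lt-flip (x≢y ∘ sym ∘ f-inj y∈ x∈)) (lt-flip (x≢y ∘ sym ∘ g-inj y∈ x∈)))
    (⁻¹-+-⁻¹ (lt (f x) (f y)) (lt (g x) (g y)))

-- Positions

position-here : ∀ (w : Fin n) ws → position (w ∷ ws) w ≡ 0
position-here w ws with w Fin.≟ w
... | yes _  = refl
... | no w≢w = contradiction refl w≢w

position-there : ∀ {w v : Fin n} ws → w ≢ v → position (w ∷ ws) v ≡ suc (position ws v)
position-there {w = w} {v} ws w≢v with w Fin.≟ v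
... | yes w≡v = contradiction w≡v w≢v
... | no _    = refl

-- All vertices outside `ws` share the position `length ws`, so injectivity is claimed for entries
-- only.
position-injective : ∀ (ws : List (Fin n)) {u v} → u List.∈ ws → v List.∈ ws →
  position ws u ≡ position ws v → u ≡ v
position-injective (w ∷ ws) {u} {v} u∈ v∈ eq with w Fin.≟ u | w Fin.≟ v
... | yes refl | yes refl = refl
position-injective (w ∷ ws) (here refl) _ _ | no w≢u | _ = contradiction refl w≢u
position-injective (w ∷ ws) _ (here refl) _ | _ | no w≢v = contradiction refl w≢v
position-injective (w ∷ ws) (there u∈) (there v∈) eq | no _ | no _ =
  position-injective ws u∈ v∈ (ℕ.suc-injective eq)

inversions-map-suc : ∀ xs → inversions (List.map suc xs) ≡ inversions xs
inversions-map-suc []       = refl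
inversions-map-suc (x ∷ xs) = cong₂ ℕ._+_ (count xs) (inversions-map-suc xs)
  where
  count : ∀ ys → length (filter (ℕ._<? suc x) (List.map suc ys)) ≡ length (filter (ℕ._<? x) ys)
  count []       = refl
  count (y ∷ ys) with y ℕ.<ᵇ x
  ... | true  = cong suc (count ys)
  ... | false = count ys

-- Read along `ws` itself, the positions are 0, 1, 2, and so on: uniqueness keeps the head out of
-- the tail, whose positions therefore all shift by one.
inversions-positions : ∀ (ws : List (Fin n)) → Unique ws →
  inversions (List.map (position ws) ws) ≡ 0
inversions-positions []       _          = refl
inversions-positions (w ∷ ws) (w∉ ∷ ws!) = begin
  inversions (List.map (position (w ∷ ws)) (w ∷ ws))
    ≡⟨ cong₂ (λ p ps → inversions (p ∷ ps)) (position-here w ws)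
         (trans (shifted w∉) (map-∘ ws)) ⟩
  inversions (0 ∷ List.map suc (List.map (position ws) ws))
    ≡⟨ cong₂ ℕ._+_
         (cong length (filter-none (ℕ._<? 0)
           (All.universal (λ _ ()) (List.map suc (List.map (position ws) ws)))))
         (inversions-map-suc (List.map (position ws) ws)) ⟩
  inversions (List.map (position ws) ws)
    ≡⟨ inversions-positions ws ws! ⟩
  0 ∎
  where
  shifted : ∀ {vs} → All (w ≢_) vs →
    List.map (position (w ∷ ws)) vs ≡ List.map (suc ∘ position ws) vs
  shifted []         = refl
  shifted (w≢v ∷ ps) = cong₂ _∷_ (position-there ws w≢v) (shifted ps)

-- By `inv-+-↭` the sum of `inv (position ws)` and `inv toℕ` agrees on `vs` and `ws`, and its first
-- summand vanishes on `ws`. With the order of `Fin n` as common reference, the sign thus splits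
-- into one term for each ordering.
permutationSign-inv : ∀ {vs ws : List (Fin n)} → Unique ws → vs ↭ ws →
  permutationSign vs ws ≡ toSign (inv toℕ vs ℙ.+ inv toℕ ws)
permutationSign-inv {vs = vs} {ws} ws! vs↭ws = cong toSign (begin
  parity (inversions (List.map (position ws) vs))
    ≡⟨ parity-inversions (position ws) vs ⟩
  inv (position ws) vs
    ≡⟨ move _ _ _ (inv-+-↭ (position ws) toℕ
         (λ u v → position-injective ws (∈-resp-↭ vs↭ws u) (∈-resp-↭ vs↭ws v))
         (λ _ _ → Fin.toℕ-injective) Fin._≟_ vs↭ws) ⟩
  inv toℕ vs ℙ.+ (inv (position ws) ws ℙ.+ inv toℕ ws)
    ≡⟨ cong (λ p → inv toℕ vs ℙ.+ (p ℙ.+ inv toℕ ws))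
         (trans (sym (parity-inversions (position ws) ws))
                (cong parity (inversions-positions ws ws!))) ⟩
  inv toℕ vs ℙ.+ inv toℕ ws ∎)
  where
  move : ∀ p q s → p ℙ.+ q ≡ s → p ≡ q ℙ.+ s
  move p q _ refl = cancel p q
    where
    cancel : ∀ p q → p ≡ q ℙ.+ (p ℙ.+ q)
    cancel = solve-∀ parityRing

-- Incidence signs in terms of inversions

-- The parity of the index at which `y` would be inserted into `xs` sorted increasingly, that is,
-- the boundary sign for increasing orderings.
rank : Fin n → List (Fin n) → Parity
rank y = sum (λ v → lt (toℕ v) (toℕ y))

-- An entry `v` after `y` forms an inversion with `y` iff `f v < f y`; an entry before `y` does so
-- iff `f v < f y` fails. Correcting each entry of `as` by 1 gives `length as`.
inv-insert : ∀ (f : A → ℕ) {y} as {bs} → All (λ a → f a ≢ f y) as →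
  inv f (as ++ y ∷ bs) ≡
  (parity (length as) ℙ.+ sum (λ v → lt (f v) (f y)) (as ++ bs)) ℙ.+ inv f (as ++ bs)
inv-insert f     []       []            = refl
inv-insert f {y} (a ∷ as) {bs} (a≢y ∷ as≢y) = begin
  sum (below a) (as ++ y ∷ bs) ℙ.+ inv f (as ++ y ∷ bs)
    ≡⟨ cong₂ ℙ._+_ (sum-↭ (below a) (shift y as bs)) (inv-insert f as as≢y) ⟩
  (lt (f y) (f a) ℙ.+ sum (below a) (as ++ bs)) ℙ.+
  ((parity (length as) ℙ.+ sum (below y) (as ++ bs)) ℙ.+ inv f (as ++ bs))
    ≡⟨ cong₂ ℙ._+_ (cong₂ ℙ._+_ (lt-flip (a≢y ∘ sym)) refl) refl ⟩
  (lt (f a) (f y) ℙ.⁻¹ ℙ.+ sum (below a) (as ++ bs)) ℙ.+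
  ((parity (length as) ℙ.+ sum (below y) (as ++ bs)) ℙ.+ inv f (as ++ bs))
    ≡⟨ rearrange 1ℙ (lt (f a) (f y)) _ (parity (length as)) _ _ ⟩
  (parity (length as) ℙ.⁻¹ ℙ.+ (lt (f a) (f y) ℙ.+ sum (below y) (as ++ bs))) ℙ.+
  (sum (below a) (as ++ bs) ℙ.+ inv f (as ++ bs))
    ≡⟨ cong₂ ℙ._+_ (cong₂ ℙ._+_ (parity-suc (length as)) refl) refl ⟨
  (parity (suc (length as)) ℙ.+ (lt (f a) (f y) ℙ.+ sum (below y) (as ++ bs))) ℙ.+
  (sum (below a) (as ++ bs) ℙ.+ inv f (as ++ bs)) ∎
  where
  below : _ → _ → Parity
  below u v = lt (f v) (f u)

  -- o stands for 1ℙ: 1ℙ + p reduces to p ⁻¹, which the ring solver does not parse.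
  rearrange : ∀ o l s p r i →
    ((o ℙ.+ l) ℙ.+ s) ℙ.+ ((p ℙ.+ r) ℙ.+ i) ≡ ((o ℙ.+ p) ℙ.+ (l ℙ.+ r)) ℙ.+ (s ℙ.+ i)
  rearrange = solve-∀ parityRing

takeWhile-++-∷ : ∀ {P : Pred A 0ℓ} (P? : Decidable P) {as y bs} → All P as → ¬ P y →
  takeWhile P? (as ++ y ∷ bs) ≡ as
takeWhile-++-∷ P? {y = y} [] ¬py with P? y
... | yes py = contradiction py ¬py
... | no _   = refl
takeWhile-++-∷ P? {a ∷ _} (pa ∷ pas) ¬py with P? a
... | yes _  = cong (a ∷_) (takeWhile-++-∷ P? pas ¬py)
... | no ¬pa = contradiction pa ¬pa

infix 4 _≋_

-- Only membership is recorded, so a face can be matched with a list in any convenient order.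
_≋_ : Subset n → List (Fin n) → Set
F ≋ xs = ∀ {v} → v ∈ F ⇔ v List.∈ xs

≋-↭ : ∀ {F : Subset n} {xs ys} → F ≋ xs → xs ↭ ys → F ≋ ys
≋-↭ F≋xs p = mk⇔ (∈-resp-↭ p ∘ Equivalence.to F≋xs) (Equivalence.from F≋xs ∘ ∈-resp-↭ (↭-sym p))

orderingParity : {F : Subset n} → Ordering F → Parity
orderingParity oF = inv toℕ (Ordering.list oF)

ordering-↭ : ∀ {F : Subset n} {xs} (oF : Ordering F) → Unique xs → F ≋ xs → Ordering.list oF ↭ xs
ordering-↭ oF xs! F≋xs = unique∧set⇒↭ (Ordering.unique oF) xs! (mk⇔
  (Equivalence.to F≋xs ∘ Equivalence.to (Ordering.complete oF))
  (Equivalence.from (Ordering.complete oF) ∘ Equivalence.from F≋xs))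

-- If the ordering of `H` is `as ++ y ∷ bs`, the definition gives `length as` plus the permutation
-- sign of `as ++ bs` against the ordering of `G`. By `inv-insert`, `length as` and the inversions
-- of `as ++ bs` combine to those of `H`, up to `rank y xs`.
sgn-inv : ∀ {G H : Subset n} {y xs} (oG : Ordering G) (oH : Ordering H) →
  Unique (y ∷ xs) → G ≋ xs → H ≋ y ∷ xs →
  sgn oG oH ≡ toSign ((orderingParity oG ℙ.+ orderingParity oH) ℙ.+ rank y xs)
sgn-inv {G = G} {y = y} {xs} oG oH y∷xs!@(y∉xs ∷ xs!) G≋xs H≋y∷xs
  with as , bs , os≡ ← ∈-∃++ (Equivalence.from (Ordering.complete oH)
                                (Equivalence.from H≋y∷xs (here refl)))
  -- The list of `oH` is generalised to a variable so that `os≡` can be matched with `refl`.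
  = split (Ordering.list oH) as bs os≡ (ordering-↭ oH y∷xs! H≋y∷xs)
  where
  gs = Ordering.list oG

  gs↭xs : gs ↭ xs
  gs↭xs = ordering-↭ oG xs! G≋xs

  y∉G : y ∉ G
  y∉G y∈G = All.lookup y∉xs (Equivalence.to G≋xs y∈G) refl

  rearrange : ∀ p r i g → p ℙ.+ (i ℙ.+ g) ≡ (g ℙ.+ ((p ℙ.+ r) ℙ.+ i)) ℙ.+ r
  rearrange = solve-∀ parityRing

  split : ∀ os as bs → os ≡ as ++ y ∷ bs → os ↭ y ∷ xs →
    toSign (parity (length (takeWhile (_∈? G) os))) Sign.*
      permutationSign (filter (_∈? G) os) gs
    ≡ toSign ((orderingParity oG ℙ.+ inv toℕ os) ℙ.+ rank y xs)
  split _ as bs refl os↭ = begin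
    toSign (parity (length (takeWhile (_∈? G) (as ++ y ∷ bs)))) Sign.*
      permutationSign (filter (_∈? G) (as ++ y ∷ bs)) gs
      ≡⟨ cong₂ (λ us vs → toSign (parity (length us)) Sign.* permutationSign vs gs)
           (takeWhile-++-∷ (_∈? G) as⊆G y∉G) filtered ⟩
    toSign (parity (length as)) Sign.* permutationSign (as ++ bs) gs
      ≡⟨ cong (toSign (parity (length as)) Sign.*_)
           (permutationSign-inv (Ordering.unique oG) (_↭_.trans as++bs↭xs (↭-sym gs↭xs))) ⟩
    toSign (parity (length as)) Sign.* toSign (inv toℕ (as ++ bs) ℙ.+ inv toℕ gs)
      ≡⟨ ℙ.+-homo-* (parity (length as)) _ ⟨
    toSign (parity (length as) ℙ.+ (inv toℕ (as ++ bs) ℙ.+ inv toℕ gs))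
      -- The rank is added twice, which changes nothing modulo 2.
      ≡⟨ cong toSign (rearrange (parity (length as)) (rank y (as ++ bs)) _ (inv toℕ gs)) ⟩
    toSign ((inv toℕ gs ℙ.+ ((parity (length as) ℙ.+ rank y (as ++ bs)) ℙ.+ inv toℕ (as ++ bs)))
      ℙ.+ rank y (as ++ bs))
      ≡⟨ cong₂ (λ p q → toSign ((inv toℕ gs ℙ.+ p) ℙ.+ q))
           (sym (inv-insert toℕ as (All.map (λ y≢a a≡y → y≢a (sym (Fin.toℕ-injective a≡y))) y∉as)))
           (sum-↭ _ as++bs↭xs) ⟩
    toSign ((inv toℕ gs ℙ.+ inv toℕ (as ++ y ∷ bs)) ℙ.+ rank y xs) ∎
    where
    as++bs↭xs : as ++ bs ↭ xs
    as++bs↭xs = drop-mid as [] os↭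

    in-G : ∀ {v} → v List.∈ as ++ bs → v ∈ G
    in-G v∈ = Equivalence.from G≋xs (∈-resp-↭ as++bs↭xs v∈)

    as⊆G : All (_∈ G) as
    as⊆G = All.tabulate (in-G ∘ ∈-++⁺ˡ)

    y∉as : All (y ≢_) as
    y∉as = All.map (λ { a∈G refl → y∉G a∈G }) as⊆G

    filtered : filter (_∈? G) (as ++ y ∷ bs) ≡ as ++ bs
    filtered = begin
      filter (_∈? G) (as ++ y ∷ bs)
        ≡⟨ filter-++ (_∈? G) as (y ∷ bs) ⟩
      filter (_∈? G) as ++ filter (_∈? G) (y ∷ bs)
        ≡⟨ cong₂ _++_ (filter-all (_∈? G) as⊆G)
             (trans (filter-reject (_∈? G) y∉G)
                    (filter-all (_∈? G) (All.tabulate (in-G ∘ ∈-++⁺ʳ as)))) ⟩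
      as ++ bs ∎

-- Up to sign, the product along the path G – H – G′ is the product of the
-- potentials of its endpoints: H does not contribute.
potential : {G : Subset n} → Ordering G → Fin n → List (Fin n) → Parity
potential oG x t = orderingParity oG ℙ.+ rank x t

-- The parity of `H` occurs twice and cancels. Inserting `y` into `x ∷ t` and `x` into `y ∷ t`
-- compares `x` with `y` in both directions; exactly one comparison holds, whence the `⁻¹`. The
-- ranks over `t` trade places: `rank y t` arises from `G` but is counted in the potential of `G′`.
sgn-path : ∀ {G G′ H : Subset n} {x y t} (oG : Ordering G) (oG′ : Ordering G′) (oH : Ordering H) →
  Unique (x ∷ y ∷ t) → G ≋ x ∷ t → G′ ≋ y ∷ t → H ≋ x ∷ y ∷ t →
  sgn oG oH Sign.* sgn oG′ oH ≡ toSign ((potential oG x t ℙ.+ potential oG′ y t) ℙ.⁻¹)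
sgn-path {x = x} {y} {t} oG oG′ oH ((x≢y ∷ x∉t) ∷ y∉t ∷ t!) G≋ G′≋ H≋ = begin
  sgn oG oH Sign.* sgn oG′ oH
    ≡⟨ cong₂ Sign._*_
         (sgn-inv oG oH (((x≢y ∘ sym) ∷ y∉t) ∷ x∉t ∷ t!) G≋ (≋-↭ H≋ (swap x y refl)))
         (sgn-inv oG′ oH ((x≢y ∷ x∉t) ∷ y∉t ∷ t!) G′≋ H≋) ⟩
  toSign ((g ℙ.+ h) ℙ.+ (lt (toℕ x) (toℕ y) ℙ.+ rank y t)) Sign.*
  toSign ((g′ ℙ.+ h) ℙ.+ (lt (toℕ y) (toℕ x) ℙ.+ rank x t))
    ≡⟨ ℙ.+-homo-* ((g ℙ.+ h) ℙ.+ (lt (toℕ x) (toℕ y) ℙ.+ rank y t)) _ ⟨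
  toSign (((g ℙ.+ h) ℙ.+ (lt (toℕ x) (toℕ y) ℙ.+ rank y t)) ℙ.+
          ((g′ ℙ.+ h) ℙ.+ (lt (toℕ y) (toℕ x) ℙ.+ rank x t)))
    ≡⟨ cong toSign (cong₂ ℙ._+_ (cong ((g ℙ.+ h) ℙ.+_)
         (cong (ℙ._+ rank y t) (lt-flip (x≢y ∘ Fin.toℕ-injective)))) refl) ⟩
  toSign (((g ℙ.+ h) ℙ.+ (lt (toℕ y) (toℕ x) ℙ.⁻¹ ℙ.+ rank y t)) ℙ.+
          ((g′ ℙ.+ h) ℙ.+ (lt (toℕ y) (toℕ x) ℙ.+ rank x t)))
    ≡⟨ cong toSign (rearrange 1ℙ g g′ h (lt (toℕ y) (toℕ x)) (rank x t) (rank y t)) ⟩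
  toSign ((potential oG x t ℙ.+ potential oG′ y t) ℙ.⁻¹) ∎
  where
  g = orderingParity oG
  g′ = orderingParity oG′
  h = orderingParity oH

  rearrange : ∀ o g g′ h l r r′ →
    ((g ℙ.+ h) ℙ.+ ((o ℙ.+ l) ℙ.+ r′)) ℙ.+ ((g′ ℙ.+ h) ℙ.+ (l ℙ.+ r)) ≡
    o ℙ.+ ((g ℙ.+ r) ℙ.+ (g′ ℙ.+ r′))
  rearrange = solve-∀ parityRing

-- Subsets and lists

fromList : List (Fin n) → Subset n
fromList = List.foldr (λ x F → ⁅ x ⁆ ∪ F) ∅

fromList-≋ : ∀ (xs : List (Fin n)) → fromList xs ≋ xs
fromList-≋ xs = mk⇔ (to xs) (from xs)
  where
  to : ∀ xs {v} → v ∈ fromList xs → v List.∈ xs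
  to []       v∈ = contradiction v∈ ∉⊥
  to (x ∷ xs) v∈ with x∈p∪q⁻ ⁅ x ⁆ (fromList xs) v∈
  ... | inj₁ v∈⁅x⁆ = here (x∈⁅y⁆⇒x≡y x v∈⁅x⁆)
  ... | inj₂ v∈xs  = there (to xs v∈xs)

  from : ∀ xs {v} → v List.∈ xs → v ∈ fromList xs
  from (x ∷ xs) (here refl) = x∈p∪q⁺ (inj₁ (x∈⁅x⁆ x))
  from (x ∷ xs) (there v∈)  = x∈p∪q⁺ (inj₂ (from xs v∈))

toList : Subset n → List (Fin n)
toList Vec.[]            = []
toList (inside  Vec.∷ F) = Fin.zero ∷ List.map Fin.suc (toList F)
toList (outside Vec.∷ F) = List.map Fin.suc (toList F)

toList-≋ : ∀ (F : Subset n) → F ≋ toList F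
toList-≋ F = mk⇔ (to F) (from F)
  where
  to : ∀ {n} (F : Subset n) {v} → v ∈ F → v List.∈ toList F
  to (inside  Vec.∷ F) Vec.here       = here refl
  to (inside  Vec.∷ F) (Vec.there v∈) = there (∈-map⁺ Fin.suc (to F v∈))
  to (outside Vec.∷ F) (Vec.there v∈) = ∈-map⁺ Fin.suc (to F v∈)

  from : ∀ {n} (F : Subset n) {v} → v List.∈ toList F → v ∈ F
  from (inside  Vec.∷ F) (here refl) = Vec.here
  from (inside  Vec.∷ F) (there v∈) with _ , u∈ , refl ← ∈-map⁻ Fin.suc v∈ = Vec.there (from F u∈)
  from (outside Vec.∷ F) v∈         with _ , u∈ , refl ← ∈-map⁻ Fin.suc v∈ = Vec.there (from F u∈)

toList-unique : ∀ (F : Subset n) → Unique (toList F)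
toList-unique Vec.[]            = []
toList-unique (inside  Vec.∷ F) =
  All.tabulate (λ v∈ → λ { refl → case ∈-map⁻ Fin.suc v∈ of λ () }) ∷
  Unique.map⁺ Fin.suc-injective (toList-unique F)
toList-unique (outside Vec.∷ F) = Unique.map⁺ Fin.suc-injective (toList-unique F)

length-toList : ∀ (F : Subset n) → length (toList F) ≡ ∣ F ∣
length-toList Vec.[]            = refl
length-toList (inside  Vec.∷ F) = cong suc (trans (length-map Fin.suc (toList F)) (length-toList F))
length-toList (outside Vec.∷ F) = trans (length-map Fin.suc (toList F)) (length-toList F)

-- Both `xs` and `toList (fromList xs)` enumerate the same set without repetition, so they are
-- permutations of each other.
∣fromList∣ : ∀ {xs : List (Fin n)} → Unique xs → ∣ fromList xs ∣ ≡ length xs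
∣fromList∣ {xs = xs} xs! = trans (sym (length-toList (fromList xs)))
  (↭-length (unique∧set⇒↭ (toList-unique (fromList xs)) xs! (mk⇔
    (Equivalence.to (fromList-≋ xs) ∘ Equivalence.from (toList-≋ (fromList xs)))
    (Equivalence.to (toList-≋ (fromList xs)) ∘ Equivalence.from (fromList-≋ xs)))))

fromList-⊂ : ∀ {xs ys : List (Fin n)} {v} → (∀ {u} → u List.∈ xs → u List.∈ ys) →
  v List.∈ ys → v List.∉ xs → fromList xs ⊂ fromList ys
fromList-⊂ {xs = xs} {ys} xs⊆ys v∈ys v∉xs =
  (λ u∈ → Equivalence.from (fromList-≋ ys) (xs⊆ys (Equivalence.to (fromList-≋ xs) u∈))) ,
  _ , Equivalence.from (fromList-≋ ys) v∈ys , v∉xs ∘ Equivalence.to (fromList-≋ xs)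

fromList-≢ : ∀ xs {ys : List (Fin n)} {v} → v List.∈ xs → v List.∉ ys → fromList xs ≢ fromList ys
fromList-≢ xs {ys} v∈xs v∉ys eq = v∉ys (Equivalence.to (fromList-≋ ys)
  (subst (_ ∈_) eq (Equivalence.from (fromList-≋ xs) v∈xs)))

-- The unbalanced hexagon

-- The index is written as `length t`, so the cardinalities required of the six faces hold by
-- `refl`.
hexagon-unbalanced : ∀ (K : SimplicialComplex n) (o : Orientation K) {F a b c t} → Face K F →
  Unique (a ∷ b ∷ c ∷ t) → (∀ {v} → v List.∈ a ∷ b ∷ c ∷ t → v ∈ F) →
  Unbalanced (B (length t) K o)
hexagon-unbalanced K o {F} {a} {b} {c} {t} face
  ((a≢b ∷ a≢c ∷ a∉t) ∷ (b≢c ∷ b∉t) ∷ c∉t ∷ t!) l⊆F balanced =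
  contradiction (trans (sym (balanced cycle)) negative) λ ()
  where
  simplex : ∀ xs → Unique xs → (∀ {v} → v List.∈ xs → v List.∈ a ∷ b ∷ c ∷ t) →
    ∀ {j} → length xs ≡ suc j → S j K
  simplex xs xs! xs⊆ len = fromList xs ,
    [ closed K (λ v∈ → l⊆F (xs⊆ (Equivalence.to (fromList-≋ xs) v∈))) face
    , trans (∣fromList∣ xs!) len ]

  t⊆ : ∀ {v} → v List.∈ t → v List.∈ a ∷ b ∷ c ∷ t
  t⊆ = there ∘ there ∘ there

  Ga Gb Gc : S (length t) K
  Ga = simplex (a ∷ t) (a∉t ∷ t!) (λ { (here p) → here p ; (there p) → t⊆ p }) refl
  Gb = simplex (b ∷ t) (b∉t ∷ t!) (λ { (here p) → there (here p) ; (there p) → t⊆ p }) refl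
  Gc = simplex (c ∷ t) (c∉t ∷ t!) (there ∘ there) refl

  ab! : Unique (a ∷ b ∷ t)
  ab! = (a≢b ∷ a∉t) ∷ b∉t ∷ t!
  bc! : Unique (b ∷ c ∷ t)
  bc! = (b≢c ∷ b∉t) ∷ c∉t ∷ t!
  -- The cyclic order `c ∷ a` gives all three paths the same form: first vertex dropped last, second
  -- vertex dropped first.
  ca! : Unique (c ∷ a ∷ t)
  ca! = ((a≢c ∘ sym) ∷ c∉t) ∷ a∉t ∷ t!

  Hab Hbc Hca : S (suc (length t)) K
  Hab = simplex (a ∷ b ∷ t) ab!
    (λ { (here p) → here p ; (there (here p)) → there (here p)
       ; (there (there p)) → t⊆ p }) refl
  Hbc = simplex (b ∷ c ∷ t) bc! there refl
  Hca = simplex (c ∷ a ∷ t) ca!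
    (λ { (here p) → there (there (here p)) ; (there (here p)) → here p
       ; (there (there p)) → t⊆ p }) refl

  first-⊂ : ∀ {x y} → Unique (x ∷ y ∷ t) → fromList (x ∷ t) ⊂ fromList (x ∷ y ∷ t)
  first-⊂ ((x≢y ∷ _) ∷ y∉t ∷ _) = fromList-⊂
    (λ { (here p) → here p ; (there p) → there (there p) })
    (there (here refl))
    (λ { (here y≡x) → x≢y (sym y≡x) ; (there y∈t) → All.lookup y∉t y∈t refl })

  second-⊂ : ∀ {x y} → Unique (x ∷ y ∷ t) → fromList (y ∷ t) ⊂ fromList (x ∷ y ∷ t)
  second-⊂ x∷y∷t! = fromList-⊂ there (here refl) (Unique.Unique[x∷xs]⇒x∉xs x∷y∷t!)

  Γ : SignedGraph
  Γ = B (length t) K o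

  -- Vertices are explicit because an adjacency proof is just a strict inclusion of subsets, from
  -- which they cannot be inferred.
  step : ∀ u v {w} → SignedGraph._~_ Γ u v → Walk Γ v w → Walk Γ u w
  step _ _ e w = e ◅ w

  hexagonWalk : Walk Γ (inj₁ Ga) (inj₁ Ga)
  hexagonWalk =
    step (inj₁ Ga)  (inj₂ Hab) (first-⊂ ab!)  (
    step (inj₂ Hab) (inj₁ Gb)  (second-⊂ ab!) (
    step (inj₁ Gb)  (inj₂ Hbc) (first-⊂ bc!)  (
    step (inj₂ Hbc) (inj₁ Gc)  (second-⊂ bc!) (
    step (inj₁ Gc)  (inj₂ Hca) (first-⊂ ca!)  (
    step (inj₂ Hca) (inj₁ Ga)  (second-⊂ ca!) ε)))))

  distinct₁ : ∀ {G G′ : S (length t) K} → value G ≢ value G′ →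
    inj₁ {B = S (suc (length t)) K} G ≢ inj₁ G′
  distinct₁ G≢G′ refl = G≢G′ refl

  distinct₂ : ∀ {H H′ : S (suc (length t)) K} → value H ≢ value H′ →
    inj₂ {A = S (length t) K} H ≢ inj₂ H′
  distinct₂ H≢H′ refl = H≢H′ refl

  ∉-∷ : ∀ {x y : Fin _} {xs} → x ≢ y → x List.∉ xs → x List.∉ y ∷ xs
  ∉-∷ x≢y _    (here x≡y) = x≢y x≡y
  ∉-∷ _   x∉xs (there x∈) = x∉xs x∈

  ∉t : ∀ {x} → All (x ≢_) t → x List.∉ t
  ∉t x∉t x∈t = All.lookup x∉t x∈t refl

  -- The vertex `b` separates `Hca` from both `Hab` and `Hbc`.
  b∉ca : b List.∉ c ∷ a ∷ t
  b∉ca = ∉-∷ b≢c (∉-∷ (a≢b ∘ sym) (∉t b∉t))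

  cycle : Cycle Γ
  cycle = record
    { walk     = hexagonWalk
    ; distinct =
        -- Rows follow the order `Ga`, `Hab`, `Gb`, `Hbc`, `Gc`, `Hca`; each `λ ()` is a pair from
        -- opposite sides of the bipartition.
        ((λ ()) ∷ distinct₁ (fromList-≢ (a ∷ t) (here refl) (∉-∷ a≢b (∉t a∉t)))
          ∷ (λ ()) ∷ distinct₁ (fromList-≢ (a ∷ t) (here refl) (∉-∷ a≢c (∉t a∉t)))
          ∷ (λ ()) ∷ [])
      ∷ ((λ ()) ∷ distinct₂ (fromList-≢ (a ∷ b ∷ t) (here refl) (∉-∷ a≢b (∉-∷ a≢c (∉t a∉t))))
          ∷ (λ ()) ∷ distinct₂ (fromList-≢ (a ∷ b ∷ t) (there (here refl)) b∉ca) ∷ [])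
      ∷ ((λ ()) ∷ distinct₁ (fromList-≢ (b ∷ t) (here refl) (∉-∷ b≢c (∉t b∉t))) ∷ (λ ()) ∷ [])
      ∷ ((λ ()) ∷ distinct₂ (fromList-≢ (b ∷ c ∷ t) (here refl) b∉ca) ∷ [])
      ∷ ((λ ()) ∷ [])
      ∷ []
      ∷ []
    ; long     = s≤s (s≤s (s≤s z≤n))
    }

  ordering : ∀ {j} (F : S j K) → Ordering (value F)
  ordering F = o (refine proj₁ F)

  u : (G : S (length t) K) → Fin _ → Parity
  u G x = potential (ordering G) x t

  -- Each potential occurs twice and cancels, leaving the three `⁻¹`, an odd number.
  oddPairs : ∀ p q r →
    toSign ((p ℙ.+ q) ℙ.⁻¹) Sign.*
    (toSign ((q ℙ.+ r) ℙ.⁻¹) Sign.* (toSign ((r ℙ.+ p) ℙ.⁻¹) Sign.* Sign.+))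
    ≡ Sign.-
  oddPairs 0ℙ 0ℙ 0ℙ = refl
  oddPairs 0ℙ 0ℙ 1ℙ = refl
  oddPairs 0ℙ 1ℙ 0ℙ = refl
  oddPairs 0ℙ 1ℙ 1ℙ = refl
  oddPairs 1ℙ 0ℙ 0ℙ = refl
  oddPairs 1ℙ 0ℙ 1ℙ = refl
  oddPairs 1ℙ 1ℙ 0ℙ = refl
  oddPairs 1ℙ 1ℙ 1ℙ = refl

  -- Groups the six edge signs by the larger face they share, as `sgn-path` requires.
  pairUp : ∀ p p′ q q′ r r′ →
    p Sign.* (p′ Sign.* (q Sign.* (q′ Sign.* (r Sign.* (r′ Sign.* Sign.+))))) ≡
    (p Sign.* p′) Sign.* ((q Sign.* q′) Sign.* ((r Sign.* r′) Sign.* Sign.+))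
  pairUp p p′ q q′ r r′ = trans (sym (Sign.*-assoc p p′ _))
    (cong ((p Sign.* p′) Sign.*_) (trans (sym (Sign.*-assoc q q′ _))
      (cong ((q Sign.* q′) Sign.*_) (sym (Sign.*-assoc r r′ Sign.+)))))

  σ : S (length t) K → S (suc (length t)) K → Sign
  σ G H = sgn (ordering G) (ordering H)

  path : ∀ {x y} (G G′ : S (length t) K) (H : S (suc (length t)) K) →
    Unique (x ∷ y ∷ t) → value G ≋ x ∷ t → value G′ ≋ y ∷ t → value H ≋ x ∷ y ∷ t →
    σ G H Sign.* σ G′ H ≡ toSign ((u G x ℙ.+ u G′ y) ℙ.⁻¹)
  path G G′ H = sgn-path (ordering G) (ordering G′) (ordering H)

  negative : walkSign Γ hexagonWalk ≡ Sign.-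
  negative = begin
    walkSign Γ hexagonWalk
      ≡⟨ pairUp (σ Ga Hab) (σ Gb Hab) (σ Gb Hbc) (σ Gc Hbc) (σ Gc Hca) (σ Ga Hca) ⟩
    (σ Ga Hab Sign.* σ Gb Hab) Sign.*
    ((σ Gb Hbc Sign.* σ Gc Hbc) Sign.* ((σ Gc Hca Sign.* σ Ga Hca) Sign.* Sign.+))
      ≡⟨ cong₂ Sign._*_
           (path Ga Gb Hab ab! (fromList-≋ (a ∷ t)) (fromList-≋ (b ∷ t)) (fromList-≋ (a ∷ b ∷ t)))
           (cong₂ Sign._*_
             (path Gb Gc Hbc bc! (fromList-≋ (b ∷ t)) (fromList-≋ (c ∷ t)) (fromList-≋ (b ∷ c ∷ t)))
             (cong (Sign._* Sign.+)
               (path Gc Ga Hca ca! (fromList-≋ (c ∷ t)) (fromList-≋ (a ∷ t))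
                 (fromList-≋ (c ∷ a ∷ t))))) ⟩
    toSign ((u Ga a ℙ.+ u Gb b) ℙ.⁻¹) Sign.*
    (toSign ((u Gb b ℙ.+ u Gc c) ℙ.⁻¹) Sign.* (toSign ((u Gc c ℙ.+ u Ga a) ℙ.⁻¹) Sign.* Sign.+))
      ≡⟨ oddPairs (u Ga a) (u Gb b) (u Gc c) ⟩
    Sign.- ∎

-- From the dimensions to a large face of the join.

largeFace⇒unbalanced : ∀ (K : SimplicialComplex n) (o : Orientation K) {F xs} i → Face K F →
  Unique xs → (∀ {v} → v List.∈ xs → v ∈ F) → 3 ℕ.+ i ℕ.≤ length xs → Unbalanced (B i K o)
largeFace⇒unbalanced K o {xs = xs@(a ∷ b ∷ c ∷ ys)} i face xs! xs⊆F (s≤s (s≤s (s≤s i≤∣ys∣))) =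
  -- Here `t` is `take i ys`, whose length equals `i` only propositionally.
  subst (λ j → Unbalanced (B j K o))
    (trans (length-take i ys) (ℕ.m≤n⇒m⊓n≡m i≤∣ys∣))
    (hexagon-unbalanced K o face (Unique.take⁺ (3 ℕ.+ i) xs!)
      (λ {v} v∈ → xs⊆F (subst (v List.∈_) (take++drop≡id (3 ℕ.+ i) xs) (∈-++⁺ˡ v∈))))

dim-attained : ∀ (K : SimplicialComplex n) → ∃ λ F → Face K F × dim K ≡ + ∣ F ∣ ℤ.- ℤ.1ℤ
dim-attained {n} K
  with argmax-sel id ℤ.-1ℤ (List.map (λ F → + ∣ F ∣ ℤ.- ℤ.1ℤ) (filter (Face? K) (subsets n)))
  where open Data.List.Extrema ℤ.≤-totalOrder using (argmax-sel)
-- The starting value -1 of the maximum is attained by the empty face.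
... | inj₁ eq = ∅ , ∅-face K , trans eq (cong (λ k → + k ℤ.- ℤ.1ℤ) (sym (∣⊥∣≡0 n)))
... | inj₂ ∈map with F , F∈ , eq ← ∈-map⁻ _ ∈map =
  F , proj₂ (∈-filter⁻ (Face? K) {xs = subsets n} F∈) , eq

-- Each dimension is one less than a cardinality; adding 2 to both sides turns the bound `i + 1`
-- into the `i + 3` vertices of the hexagon.
pred+pred≥ : ∀ p q {i} → (+ p ℤ.- ℤ.1ℤ) + (+ q ℤ.- ℤ.1ℤ) ≥ + suc i → 3 ℕ.+ i ℕ.≤ p ℕ.+ q
pred+pred≥ p q {i} ge = ℤ.drop‿+≤+
  (subst (+ (3 ℕ.+ i) ℤ.≤_) (rearrange (+ p) (+ q)) (ℤ.+-monoʳ-≤ (+ 2) ge))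
  where
  rearrange : ∀ x y → + 2 + ((x ℤ.- ℤ.1ℤ) + (y ℤ.- ℤ.1ℤ)) ≡ x + y
  rearrange = ℤSolver.solve-∀

mainTheorem9 : ∀ {n : ℕ} (K₁ K₂ : SimplicialComplex n) →
    HasVertex K₁ → HasVertex K₂ → DisjointVertices K₁ K₂ →
    (i : ℕ) → dim K₁ + dim K₂ ≥ + suc i →
    (o : Orientation (K₁ ∗ K₂)) → Unbalanced (B i (K₁ ∗ K₂) o)
mainTheorem9 K₁ K₂ _ _ disjoint i ge o
  with F₁ , face₁ , dim₁ ← dim-attained K₁ | F₂ , face₂ , dim₂ ← dim-attained K₂
  = largeFace⇒unbalanced (K₁ ∗ K₂) o i (F₁ , F₂ , face₁ , face₂ , refl)
      -- A common element of `F₁` and `F₂` would be a vertex of both complexes, so the concatenation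
      -- has no repetition.
      (Unique.++⁺ (toList-unique F₁) (toList-unique F₂)
        (λ {v} (v∈₁ , v∈₂) → disjoint v
          ( vertex K₁ face₁ (Equivalence.from (toList-≋ F₁) v∈₁)
          , vertex K₂ face₂ (Equivalence.from (toList-≋ F₂) v∈₂))))
      (λ v∈ → x∈p∪q⁺ (Sum.map (Equivalence.from (toList-≋ F₁)) (Equivalence.from (toList-≋ F₂))
                        (∈-++⁻ (toList F₁) v∈)))
      (subst (3 ℕ.+ i ℕ.≤_)
        (sym (trans (length-++ (toList F₁)) (cong₂ ℕ._+_ (length-toList F₁) (length-toList F₂))))
        (pred+pred≥ ∣ F₁ ∣ ∣ F₂ ∣ (subst (ℤ._≥ + suc i) (cong₂ _+_ dim₁ dim₂) ge)))
  where
  vertex : ∀ (K : SimplicialComplex _) {F v} → Face K F → v ∈ F → Vertex K v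
  vertex K {F} {v} face v∈F = closed K (λ u∈ → subst (_∈ F) (sym (x∈⁅y⁆⇒x≡y v u∈)) v∈F) face
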